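{- Let $n\ge1$ and $1\le i\le n$. The number of parking functions of $1,\ldots,n$ for which the $i$-th car is lucky is \[ \sum_{j=1}^nq_n(i,j)=(n+2-i)(n+1)^{n-2}=\Big(1-\frac{i-1}{n+1}\Big)(n+1)^{n-1}. \]
   Context: There are $n$ spots labeled $1,\ldots,n$ in order along a one-way street, and $n$ cars entering one after another, car $i$ having preference $a_i\in\{1,\ldots,n\}$. Each car drives to its preferred spot and parks there if it is available; otherwise it moves forward and parks in the first available later spot, if any (if none, it fails to park). A parking function of $1,\ldots,n$ is a sequence of preferences $(a_1,\ldots,a_n)$ such that all $n$ cars are able to park. A car is lucky if it parks in its preferred spot. For $1\le i,j\le n$, $q_n(i,j)$ denotes the number of parking functions of $1,\ldots,n$ in which the $i$-th car prefers the $j$-th spot and the $i$-th car is lucky. Negative exponents are interpreted in the rational numbers. -}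

module Defs where

open import Algebra.Bundles using (CommutativeRing)
open import Data.Fin using (Fin; toℕ; _≤?_; _≟_)
open import Data.Fin.Properties using (all?)
open import Data.Fin.Subset using (Subset; inside; ⊥)
open import Data.Fin.Subset.Properties using (_∈?_)
open import Data.Integer using (ℤ; +_; -[1+_])
open import Data.List using (List; []; _∷_; allFin; cartesianProductWith; filter; find; length)
open import Data.Maybe using (Maybe; just; maybe′; Is-just)
open import Data.Maybe.Properties using (≡-dec)
open import Data.Maybe.Relation.Unary.Any using (dec)
open import Data.Nat using (ℕ; zero; suc)
open import Data.Product using (_×_)
open import Data.Rational using (ℚ; NonZero; 1/_)
open import Data.Rational.Properties using (+-*-commutativeRing)
open import Data.Unit using (tt)
open import Data.Vec using (Vec; []; _∷_; lookup; _[_]≔_)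
open import Relation.Binary.PropositionalEquality using (_≡_)
open import Relation.Nullary using (Dec; yes)
open import Relation.Nullary.Decidable using (_×-dec_; ¬?)

import Algebra.Properties.Semiring.Exp (CommutativeRing.semiring +-*-commutativeRing) as Exp

private
  variable
    m n : ℕ

-- Cars and spots are elements of `Fin n`; the label of `k : Fin n` in 1, …, n
-- is one more than its underlying number.
label : Fin n → ℕ
label k = suc (toℕ k)

Preferences : ℕ → Set
Preferences n = Vec (Fin n) n

-- The first spot, at or after the preferred one, that is not in the set of
-- occupied spots. Trying the preferred spot first and then the later ones in
-- order amounts to exactly this, because `allFin` lists the spots in increasing
-- order and `find` returns the first match.
spotFor : Subset n → Fin n → Maybe (Fin n)
spotFor {n} occupied a =
  find (λ s → (a ≤? s) ×-dec ¬? (s ∈? occupied)) (allFin n)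

-- The spots taken by successive cars, `nothing` marking a car that fails to
-- park; such a car leaves the street unchanged for its successors.
parkFrom : Subset n → Vec (Fin n) m → Vec (Maybe (Fin n)) m
parkFrom occupied []       = []
parkFrom occupied (a ∷ as) = s ∷ parkFrom (maybe′ (occupied [_]≔ inside) occupied s) as
  where s = spotFor occupied a

parkedSpot : Preferences n → Fin n → Maybe (Fin n)
parkedSpot a i = lookup (parkFrom ⊥ a) i

IsParkingFunction : Preferences n → Set
IsParkingFunction {n} a = ∀ (i : Fin n) → Is-just (parkedSpot a i)

Lucky : Preferences n → Fin n → Set
Lucky a i = parkedSpot a i ≡ just (lookup a i)

isParkingFunction? : (a : Preferences n) → Dec (IsParkingFunction a)
isParkingFunction? a = all? λ i → dec (λ _ → yes tt) (parkedSpot a i)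

lucky? : (a : Preferences n) (i : Fin n) → Dec (Lucky a i)
lucky? a i = ≡-dec _≟_ (parkedSpot a i) (just (lookup a i))

-- All vectors of length m over Fin n, each listed exactly once.
allVecs : ∀ n m → List (Vec (Fin n) m)
allVecs n zero    = [] ∷ []
allVecs n (suc m) = cartesianProductWith _∷_ (allFin n) (allVecs n m)

luckyCount : ∀ n → Fin n → ℕ
luckyCount n i =
  length (filter (λ a → isParkingFunction? a ×-dec lucky? a i) (allVecs n n))

q : ∀ n → Fin n → Fin n → ℕ
q n i j =
  length (filter (λ a → isParkingFunction? a ×-dec (lookup a i ≟ j) ×-dec lucky? a i)
                 (allVecs n n))

infixr 8 _^_

_^_ : (p : ℚ) → .{{_ : NonZero p}} → ℤ → ℚ
p ^ (+ k)    = p Exp.^ k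
p ^ -[1+ k ] = (1/ p) Exp.^ suc k

{-# OPTIONS --safe #-}
module Submission where

-- Pollak's circle argument. Add a spot n+1 and close the street to a circle, so
-- that n cars with preferences among the n+1 spots always park and leave one spot
-- empty. The preferences that leave spot n+1 empty are exactly the parking
-- functions, with the same cars lucky, since then no car passes that spot. By
-- rotation each spot is left empty equally often, even with car i required to be
-- lucky. On the circle that requirement only restricts the preference of car i to
-- the n+2-i spots still vacant, so (n+1) times the wanted number is
-- (n+2-i) (n+1)^(n-1).

open import Algebra.Bundles using (CommutativeRing)
open import Data.Nat.Properties using (+-0-commutativeMonoid)
open import Algebra.Properties.CommutativeMonoid.Sum +-0-commutativeMonoid
  using (sum-syntax; sum-cong-≗; sum-replicate-zero; sum-init-last; sum-remove; ∑-distrib-+; ∑-comm)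
open import Data.Bool using (true; false; if_then_else_)
open import Data.Bool.Properties using (¬-not)
open import Data.Fin using (Fin; zero; suc; toℕ; fromℕ; inject₁; punchIn)
open import Data.Fin.Properties
  using (toℕ-injective; toℕ-inject₁; toℕ-fromℕ; toℕ<n; inject₁-injective; fromℕ≢inject₁; punchInᵢ≢i; _≟_)
open import Data.Fin.Relation.Unary.Top using (view; view-fromℕ; view-inject₁; ‵fromℕ; ‵inject₁)
open import Data.Fin.Subset using (Subset; Side; inside; outside; ⊥; ⁅_⁆)
open import Data.Fin.Subset.Properties using (x∈⁅x⁆; x∈⁅y⁆⇒x≡y)
open import Data.Integer using (+_; -[1+_]; _⊖_)
  renaming (_-_ to _-ᶻ_; _+_ to _+ᶻ_; _*_ to _*ᶻ_; -_ to -ᶻ_)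
import Data.Integer.Properties as ℤ
open import Data.List using (List; []; _∷_; _++_; map; length; filter; find; tabulate; cartesianProductWith)
open import Data.List.Properties using (filter-++; length-++; filter-none; filter-all)
import Data.List.Relation.Unary.All as All
open import Data.Maybe using (just; nothing; maybe′; Is-just)
open import Data.Maybe.Properties using (just-injective)
import Data.Maybe.Relation.Unary.Any as Maybe
open import Data.Nat using (ℕ; zero; suc; _≤_; _<_; _≥_; s≤s; s≤s⁻¹; _∸_)
  renaming (_+_ to _+ᴺ_; _*_ to _*ᴺ_; _^_ to _^ᴺ_)
open import Data.Nat.GeneralisedArithmetic using (iterate)
import Data.Nat.Properties as ℕ
open import Algebra.Properties.CommutativeSemigroup ℕ.*-commutativeSemigroup using (x∙yz≈y∙xz)
open import Algebra.Properties.Semiring.Sum ℕ.+-*-semiring using (*-distribˡ-sum; *-distribʳ-sum)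
open import Data.Product using (Σ-syntax; _,_; _×_; proj₁; proj₂)
open import Data.Rational using (ℚ; 1ℚ; _-_; _+_; -_; _*_; _/_; 1/_; NonZero)
open import Data.Rational.Literals using (fromℤ)
import Data.Rational.Properties as ℚ
open import Data.Rational.Unnormalised using (mkℚᵘ; *≡*)
import Data.Rational.Unnormalised.Properties as ℚᵘ
open import Data.Vec using (Vec; []; _∷_; lookup; _[_]≔_)
open import Data.Vec.Properties
  using (lookup∘update; lookup∘update′; lookup-replicate; []=⇒lookup; lookup⇒[]=)
open import Function using (_∘_; id)
open import Relation.Binary.PropositionalEquality
open import Relation.Nullary using (Dec; ¬_; yes; no; contradiction; does)
open import Relation.Nullary.Decidable using (dec-true; dec-false)
open import Relation.Unary using (Decidable; _≐_)
open import Defs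

import Algebra.Properties.Semiring.Exp (CommutativeRing.semiring ℚ.+-*-commutativeRing) as Exp

private
  variable
    m n : ℕ
    A B C : Set
    P : A → Set

-- The circular street

∑-const : ∀ n c → ∑[ i < n ] c ≡ n *ᴺ c
∑-const zero    c = refl
∑-const (suc n) c = cong (c +ᴺ_) (∑-const n c)

next : Fin (suc n) → Fin (suc n)
next i with view i
... | ‵fromℕ     = zero
... | ‵inject₁ j = suc j

next-fromℕ : ∀ n → next (fromℕ n) ≡ zero
next-fromℕ n rewrite view-fromℕ n = refl

next-inject₁ : (i : Fin n) → next (inject₁ i) ≡ suc i
next-inject₁ i rewrite view-inject₁ i = refl

toℕ-next : (i : Fin (suc n)) → toℕ i < n → toℕ (next i) ≡ suc (toℕ i)
toℕ-next {n} i i<n with view i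
... | ‵fromℕ     = contradiction i<n (ℕ.≤⇒≯ (ℕ.≤-reflexive (sym (toℕ-fromℕ n))))
... | ‵inject₁ j = cong suc (sym (toℕ-inject₁ j))

next-injective : {i j : Fin (suc n)} → next i ≡ next j → i ≡ j
next-injective {i = i} {j} eq with view i | view j
next-injective refl | ‵fromℕ     | ‵fromℕ     = refl
next-injective refl | ‵inject₁ _ | ‵inject₁ _ = refl

-- `next` permutes the spots cyclically, so the last term of the sum merely moves to the front.
∑-next : (f : Fin (suc n) → ℕ) → ∑[ i < suc n ] f (next i) ≡ ∑[ i < suc n ] f i
∑-next {n} f = begin
  ∑[ i < suc n ] f (next i)
    ≡⟨ sum-init-last (f ∘ next) ⟩
  ∑[ i < n ] f (next (inject₁ i)) +ᴺ f (next (fromℕ n))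
    ≡⟨ cong₂ _+ᴺ_ (sum-cong-≗ (cong f ∘ next-inject₁)) (cong f (next-fromℕ n)) ⟩
  ∑[ i < n ] f (suc i) +ᴺ f zero
    ≡⟨ ℕ.+-comm (∑[ i < n ] f (suc i)) (f zero) ⟩
  ∑[ i < suc n ] f i ∎
  where open ≡-Reasoning

iterate-next : ∀ k (i j : Fin (suc n)) → toℕ j ≡ k +ᴺ toℕ i → iterate next i k ≡ j
iterate-next zero    i j eq = toℕ-injective (sym eq)
iterate-next {n} (suc k) i j eq =
  iterate-next k (next i) j (trans eq (trans (sym (ℕ.+-suc k _)) (cong (k +ᴺ_) (sym (toℕ-next i i<n)))))
  where
  -- The target `j` lies at least one step beyond `i`, so `i` is not the last spot and `next` does
  -- not wrap around here.
  i<n : toℕ i < n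
  i<n = ℕ.≤-trans (s≤s (ℕ.m≤n+m (toℕ i) k))
          (ℕ.≤-trans (ℕ.≤-reflexive (sym eq)) (s≤s⁻¹ (toℕ<n j)))

iterate-+ : ∀ (f : A → A) x j k → iterate f x (j +ᴺ k) ≡ iterate f (iterate f x j) k
iterate-+ f x zero    k = refl
iterate-+ f x (suc j) k = iterate-+ f (f x) j k

-- n ∸ toℕ i steps to the last spot, one step round to the first, toℕ j more to j.
next-reaches : ∀ (i j : Fin (suc n)) → iterate next i ((n ∸ toℕ i) +ᴺ suc (toℕ j)) ≡ j
next-reaches {n} i j = begin
  iterate next i ((n ∸ toℕ i) +ᴺ suc (toℕ j))
    ≡⟨ iterate-+ next i (n ∸ toℕ i) (suc (toℕ j)) ⟩
  iterate next (iterate next i (n ∸ toℕ i)) (suc (toℕ j))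
    ≡⟨ cong (λ x → iterate next (next x) (toℕ j))
         (iterate-next _ i (fromℕ n)
           (trans (toℕ-fromℕ n) (sym (ℕ.m∸n+n≡m (s≤s⁻¹ (toℕ<n i)))))) ⟩
  iterate next (next (fromℕ n)) (toℕ j)
    ≡⟨ cong (λ x → iterate next x (toℕ j)) (next-fromℕ n) ⟩
  iterate next zero (toℕ j)
    ≡⟨ iterate-next (toℕ j) zero j (sym (ℕ.+-identityʳ _)) ⟩
  j ∎
  where open ≡-Reasoning

-- The first argument bounds the number of spots passed.
search : ℕ → Subset (suc n) → Fin (suc n) → Fin (suc n)
search zero    S a = a
search (suc k) S a with lookup S a
... | inside  = search k S (next a)
... | outside = a

-- The bound is generous: by `next-reaches` any spot is reached from any other within `n +ᴺ suc n`
-- steps, so a vacant spot is never missed.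
circularSpot : Subset (suc n) → Fin (suc n) → Fin (suc n)
circularSpot {n} = search (n +ᴺ suc n)

circularPark : Subset (suc n) → Fin (suc n) → Subset (suc n)
circularPark S a = S [ circularSpot S a ]≔ inside

-- The search passes only occupied spots, so it cannot get beyond the vacant spot `j` steps ahead.
-- If the bound runs out, the spot returned unchecked is that one.
search-vacant : ∀ j k (S : Subset (suc n)) a → j ≤ k →
                lookup S (iterate next a j) ≡ outside → lookup S (search k S a) ≡ outside
search-vacant zero    zero    S a _     eq = eq
search-vacant j       (suc k) S a j≤k   eq with lookup S a in eqₐ
search-vacant j       (suc k) S a j≤k   eq | outside = eqₐ
search-vacant zero    (suc k) S a j≤k   eq | inside  = contradiction (trans (sym eqₐ) eq) λ ()
search-vacant (suc j) (suc k) S a j≤k   eq | inside  = search-vacant j k S (next a) (s≤s⁻¹ j≤k) eq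

circularSpot-vacant : (S : Subset (suc n)) (a e : Fin (suc n)) →
                      lookup S e ≡ outside → lookup S (circularSpot S a) ≡ outside
circularSpot-vacant {n} S a e eq =
  search-vacant _ _ S a (ℕ.+-mono-≤ (ℕ.m∸n≤m n (toℕ a)) (toℕ<n e))
    (trans (cong (lookup S) (next-reaches a e)) eq)

search-first : ∀ d k (S : Subset (suc n)) a s → d ≤ k → toℕ s ≡ d +ᴺ toℕ a →
               lookup S s ≡ outside →
               (∀ t → toℕ a ≤ toℕ t → toℕ t < toℕ s → lookup S t ≡ inside) →
               search k S a ≡ s
search-first zero zero S a s _ eq out ins = sym (toℕ-injective eq)
search-first zero (suc k) S a s _ eq out ins with toℕ-injective eq
... | refl rewrite out = refl
search-first {n} (suc d) (suc k) S a s (s≤s d≤k) eq out ins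
  rewrite ins a ℕ.≤-refl (ℕ.≤-trans (s≤s (ℕ.m≤n+m (toℕ a) d)) (ℕ.≤-reflexive (sym eq)))
  = search-first d k S (next a) s d≤k
      (trans eq (trans (sym (ℕ.+-suc d _)) (cong (d +ᴺ_) (sym a+1))))
      out
      (λ t a<t → ins t (ℕ.≤-trans (ℕ.n≤1+n _) (subst (_≤ toℕ t) a+1 a<t)))
  where
  a+1 : toℕ (next a) ≡ suc (toℕ a)
  a+1 = toℕ-next a (ℕ.≤-trans (s≤s (ℕ.m≤n+m (toℕ a) d))
          (ℕ.≤-trans (ℕ.≤-reflexive (sym eq)) (s≤s⁻¹ (toℕ<n s))))

-- This is the case without wrapping around, in the form that `spotFor-just` and `spotFor-nothing`
-- can supply.
circularSpot-first : (S : Subset (suc n)) (a s : Fin (suc n)) → toℕ a ≤ toℕ s →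
                     lookup S s ≡ outside →
                     (∀ t → toℕ a ≤ toℕ t → toℕ t < toℕ s → lookup S t ≡ inside) →
                     circularSpot S a ≡ s
circularSpot-first {n} S a s a≤s =
  search-first (toℕ s ∸ toℕ a) (n +ᴺ suc n) S a s
    (ℕ.≤-trans (ℕ.m∸n≤m _ (toℕ a)) (ℕ.≤-trans (ℕ.<⇒≤ (toℕ<n s)) (ℕ.m≤n+m _ n)))
    (sym (ℕ.m∸n+n≡m a≤s))

-- Counting vacant spots

vacant : Side → ℕ
vacant inside  = 0
vacant outside = 1

vacancies : Subset n → ℕ
vacancies {n} S = ∑[ e < n ] vacant (lookup S e)

vacancies-⊥ : ∀ n → vacancies (⊥ {n}) ≡ n
vacancies-⊥ zero    = refl
vacancies-⊥ (suc n) = cong suc (vacancies-⊥ n)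

vacancies-positive : (S : Subset n) → vacancies S ≡ suc m →
                     Σ[ e ∈ Fin n ] lookup S e ≡ outside
vacancies-positive (outside ∷ S) eq = zero , refl
vacancies-positive (inside  ∷ S) eq with vacancies-positive S eq
... | e , out = suc e , out

vacancies-[]≔ : (S : Subset n) (s : Fin n) → lookup S s ≡ outside →
                suc (vacancies (S [ s ]≔ inside)) ≡ vacancies S
vacancies-[]≔ (outside ∷ S) zero    out = refl
vacancies-[]≔ (inside  ∷ S) (suc s) out = vacancies-[]≔ S s out
vacancies-[]≔ (outside ∷ S) (suc s) out = cong suc (vacancies-[]≔ S s out)

vacancies-circularPark : (S : Subset (suc n)) (a : Fin (suc n)) →
                         vacancies S ≡ suc m → vacancies (circularPark S a) ≡ m
vacancies-circularPark S a eq with vacancies-positive S eq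
... | e , out = ℕ.suc-injective
  (trans (vacancies-[]≔ S (circularSpot S a) (circularSpot-vacant S a e out)) eq)

-- The first side says whether the car is required to be lucky, the second whether
-- its preferred spot is occupied.
weight : Side → Side → ℕ
weight inside  = vacant
weight outside = λ _ → 1

-- Sums F over the final states reached from S; L is the set of cars required to be
-- lucky.
circular : Subset m → (Subset (suc n) → ℕ) → Subset (suc n) → ℕ
circular         []      F S = F S
circular {n = n} (l ∷ L) F S =
  ∑[ a < suc n ] (weight l (lookup S a) *ᴺ circular L F (circularPark S a))

-- `circular` is a weighted sum of values of `F`, hence additive in `F`. This lets the final number
-- of vacancies be split according to which spot is left empty.
circular-∑ : ∀ k (L : Subset m) (F : Fin k → Subset (suc n) → ℕ) S →
             circular L (λ T → ∑[ e < k ] F e T) S ≡ ∑[ e < k ] circular L (F e) S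
circular-∑ k []      F S = refl
circular-∑ {n = n} k (l ∷ L) F S = begin
  ∑[ a < suc n ] (weight l (lookup S a) *ᴺ circular L (λ T → ∑[ e < k ] F e T) (circularPark S a))
    ≡⟨ sum-cong-≗ (λ a → trans
         (cong (weight l (lookup S a) *ᴺ_) (circular-∑ k L F (circularPark S a)))
         (*-distribˡ-sum (weight l (lookup S a)) (λ e → circular L (F e) (circularPark S a)))) ⟩
  ∑[ a < suc n ] ∑[ e < k ] (weight l (lookup S a) *ᴺ circular L (F e) (circularPark S a))
    ≡⟨ ∑-comm (λ a e → weight l (lookup S a) *ᴺ circular L (F e) (circularPark S a)) ⟩
  ∑[ e < k ] circular (l ∷ L) (F e) S ∎
  where open ≡-Reasoning

-- With m cars still to come (and one spot to spare) m + 1 of the n + 1 spots are vacant.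
choices : ℕ → Subset m → ℕ
choices n []            = 1
choices n (outside ∷ L) = suc n *ᴺ choices n L
choices {suc m} n (inside ∷ L) = suc (suc m) *ᴺ choices n L

-- Every car fills exactly one spot, so the number of vacant spots depends only on how many cars
-- have come, and each car contributes a factor independent of earlier choices. The final value is
-- 1, for the single spot left.
circular-vacancies : (L : Subset m) (S : Subset (suc n)) → vacancies S ≡ suc m →
                     circular L vacancies S ≡ choices n L
circular-vacancies []      S eq = eq
circular-vacancies {suc m} {n} (l ∷ L) S eq = begin
  ∑[ a < suc n ] (weight l (lookup S a) *ᴺ circular L vacancies (circularPark S a))
    ≡⟨ sum-cong-≗ (λ a → cong (weight l (lookup S a) *ᴺ_)
         (circular-vacancies L (circularPark S a) (vacancies-circularPark S a eq))) ⟩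
  ∑[ a < suc n ] (weight l (lookup S a) *ᴺ choices n L)
    ≡⟨ *-distribʳ-sum (choices n L) (λ a → weight l (lookup S a)) ⟨
  (∑[ a < suc n ] weight l (lookup S a)) *ᴺ choices n L
    ≡⟨ total l ⟩
  choices n (l ∷ L) ∎
  where
  open ≡-Reasoning
  total : ∀ l → (∑[ a < suc n ] weight l (lookup S a)) *ᴺ choices n L ≡ choices n (l ∷ L)
  total inside  = cong (_*ᴺ choices n L) eq
  total outside = cong (_*ᴺ choices n L) (trans (∑-const (suc n) 1) (ℕ.*-identityʳ (suc n)))

choices-⊥ : ∀ n m → choices n (⊥ {m}) ≡ suc n ^ᴺ m
choices-⊥ n zero    = refl
choices-⊥ n (suc m) = cong (suc n *ᴺ_) (choices-⊥ n m)

-- Each of the `toℕ i` cars before the lucky one uses up a vacancy; the `m` other cars choose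
-- freely.
choices-⁅⁆ : ∀ n (i : Fin (suc m)) → choices n ⁅ i ⁆ ≡ (suc (suc m) ∸ toℕ i) *ᴺ suc n ^ᴺ m
choices-⁅⁆ {m} n zero = cong (suc (suc m) *ᴺ_) (choices-⊥ n m)
choices-⁅⁆ {suc m} n (suc i) = begin
  suc n *ᴺ choices n ⁅ i ⁆
    ≡⟨ cong (suc n *ᴺ_) (choices-⁅⁆ n i) ⟩
  suc n *ᴺ ((suc (suc m) ∸ toℕ i) *ᴺ suc n ^ᴺ m)
    ≡⟨ x∙yz≈y∙xz (suc n) (suc (suc m) ∸ toℕ i) (suc n ^ᴺ m) ⟩
  (suc (suc m) ∸ toℕ i) *ᴺ suc n ^ᴺ suc m ∎
  where open ≡-Reasoning

-- Rotation of the circle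

Rotated : Subset (suc n) → Subset (suc n) → Set
Rotated S S′ = ∀ x → lookup S′ (next x) ≡ lookup S x

search-rotated : ∀ k {S S′ : Subset (suc n)} → Rotated S S′ → ∀ a →
                 search k S′ (next a) ≡ next (search k S a)
search-rotated zero    rot a = refl
search-rotated (suc k) {S} rot a rewrite rot a with lookup S a
... | inside  = search-rotated k rot (next a)
... | outside = refl

[]≔-rotated : {S S′ : Subset (suc n)} → Rotated S S′ → ∀ s {b} →
              Rotated (S [ s ]≔ b) (S′ [ next s ]≔ b)
[]≔-rotated {S = S} {S′} rot s {b} x with x ≟ s
... | yes refl = trans (lookup∘update (next s) S′ b) (sym (lookup∘update s S b))
... | no x≢s   = trans (lookup∘update′ (x≢s ∘ next-injective) S′ b)
                   (trans (rot x) (sym (lookup∘update′ x≢s S b)))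

circularPark-rotated : {S S′ : Subset (suc n)} → Rotated S S′ → ∀ a →
                       Rotated (circularPark S a) (circularPark S′ (next a))
circularPark-rotated {n} {S} {S′} rot a
  rewrite search-rotated (n +ᴺ suc n) {S} {S′} rot a = []≔-rotated {S = S} {S′} rot (circularSpot S a)

-- Rotating the preferences along with the occupied set rotates every parking step and keeps every
-- weight; `∑-next` then reindexes the sum over preferences.
circular-rotated : (L : Subset m) {F F′ : Subset (suc n) → ℕ} →
                   (∀ T T′ → Rotated T T′ → F T ≡ F′ T′) →
                   ∀ S S′ → Rotated S S′ → circular L F S ≡ circular L F′ S′
circular-rotated []      F≗F′ S S′ rot = F≗F′ S S′ rot
circular-rotated {n = n} (l ∷ L) {F} {F′} F≗F′ S S′ rot = begin
  ∑[ a < suc n ] (weight l (lookup S a) *ᴺ circular L F (circularPark S a))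
    ≡⟨ sum-cong-≗ (λ a → cong₂ (λ b c → weight l b *ᴺ c) (sym (rot a))
         (circular-rotated L F≗F′ (circularPark S a) (circularPark S′ (next a))
           (circularPark-rotated {S = S} {S′} rot a))) ⟩
  ∑[ a < suc n ] g (next a)
    ≡⟨ ∑-next g ⟩
  ∑[ a < suc n ] g a ∎
  where
  open ≡-Reasoning
  g : Fin (suc n) → ℕ
  g a = weight l (lookup S′ a) *ᴺ circular L F′ (circularPark S′ a)

leaving : Fin n → Subset n → ℕ
leaving e S = vacant (lookup S e)

⊥-rotated : Rotated (⊥ {suc n}) ⊥
⊥-rotated x = trans (lookup-replicate (next x) outside) (sym (lookup-replicate x outside))

circular-leaving-next : (L : Subset m) (e : Fin (suc n)) →
  circular L (leaving e) ⊥ ≡ circular L (leaving (next e)) ⊥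
circular-leaving-next L e =
  circular-rotated L (λ _ _ rot → cong vacant (sym (rot e))) ⊥ ⊥ ⊥-rotated

circular-leaving-iterate : (L : Subset m) (e : Fin (suc n)) → ∀ k →
  circular L (leaving e) ⊥ ≡ circular L (leaving (iterate next e k)) ⊥
circular-leaving-iterate L e zero    = refl
circular-leaving-iterate L e (suc k) =
  trans (circular-leaving-next L e) (circular-leaving-iterate L (next e) k)

-- The empty circle is its own rotation, so every spot is left empty equally often. Summed over all
-- spots, these counts give the total computed by `circular-vacancies`.
circular-leaving : (L : Subset n) (e : Fin (suc n)) →
                   suc n *ᴺ circular L (leaving e) ⊥ ≡ choices n L
circular-leaving {n} L e = begin
  suc n *ᴺ circular L (leaving e) ⊥
    ≡⟨ ∑-const (suc n) (circular L (leaving e) ⊥) ⟨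
  ∑[ x < suc n ] circular L (leaving e) ⊥
    ≡⟨ sum-cong-≗ (λ x → trans (circular-leaving-iterate L e ((n ∸ toℕ e) +ᴺ suc (toℕ x)))
         (cong (λ y → circular L (leaving y) ⊥) (next-reaches e x))) ⟩
  ∑[ x < suc n ] circular L (leaving x) ⊥
    ≡⟨ circular-∑ (suc n) L leaving ⊥ ⟨
  circular L vacancies ⊥
    ≡⟨ circular-vacancies L ⊥ (vacancies-⊥ (suc n)) ⟩
  choices n L ∎
  where open ≡-Reasoning

-- Comparison with the one-way street

find-just : (P? : Decidable P) (f : Fin n → A) {x : A} → find P? (tabulate f) ≡ just x →
            Σ[ i ∈ Fin n ] f i ≡ x × P (f i) × (∀ j → toℕ j < toℕ i → ¬ P (f j))
find-just {n = suc n} P? f eq with P? (f zero)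
... | yes p = zero , just-injective eq , p , λ _ ()
... | no ¬p with find-just P? (f ∘ suc) eq
...   | i , fi≡x , pi , first = suc i , fi≡x , pi , λ
  { zero    _   → ¬p
  ; (suc j) j<i → first j (s≤s⁻¹ j<i)
  }

find-nothing : (P? : Decidable P) (f : Fin n → A) → find P? (tabulate f) ≡ nothing →
               ∀ i → ¬ P (f i)
find-nothing {n = suc n} P? f eq i with P? (f zero)
find-nothing {n = suc n} P? f eq zero    | no ¬p = ¬p
find-nothing {n = suc n} P? f eq (suc i) | no ¬p = find-nothing P? (f ∘ suc) eq i

spotFor-just : (S : Subset n) (a : Fin n) {s : Fin n} → spotFor S a ≡ just s →
               toℕ a ≤ toℕ s × lookup S s ≡ outside ×
               (∀ t → toℕ a ≤ toℕ t → toℕ t < toℕ s → lookup S t ≡ inside)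
spotFor-just S a eq with find-just _ id eq
... | s , refl , (a≤s , s∉S) , first =
  a≤s , ¬-not (s∉S ∘ lookup⇒[]= s S) ,
  λ t a≤t t<s → ¬-not λ out → first t t<s (a≤t , λ t∈S → contradiction (trans (sym out) ([]=⇒lookup t∈S)) λ ())

spotFor-nothing : (S : Subset n) (a : Fin n) → spotFor S a ≡ nothing →
                  ∀ t → toℕ a ≤ toℕ t → lookup S t ≡ inside
spotFor-nothing S a eq t a≤t = ¬-not λ out →
  find-nothing _ id eq t (a≤t , λ t∈S → contradiction (trans (sym out) ([]=⇒lookup t∈S)) λ ())

spotFor-vacant : (S : Subset n) (a : Fin n) {s : Fin n} → spotFor S a ≡ just s →
                 lookup S a ≡ outside → s ≡ a
spotFor-vacant S a {s} eq out with spotFor-just S a eq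
... | a≤s , _ , ins = toℕ-injective (ℕ.≤-antisym
  (ℕ.≮⇒≥ λ a<s → contradiction (trans (sym out) (ins a ℕ.≤-refl a<s)) λ ()) a≤s)

-- The one-way counterpart of `circular`. The default 0 discards every sequence in which some car
-- fails to park.
linear : Subset m → Subset n → ℕ
linear         []      S = 1
linear {n = n} (l ∷ L) S =
  ∑[ a < n ] (weight l (lookup S a) *ᴺ maybe′ (λ s → linear L (S [ s ]≔ inside)) 0 (spotFor S a))

[]≔-inside : (S : Subset n) (s e : Fin n) → lookup S e ≡ inside → lookup (S [ s ]≔ inside) e ≡ inside
[]≔-inside S s e ins with e ≟ s
... | yes refl = lookup∘update s S inside
... | no e≢s   = trans (lookup∘update′ e≢s S inside) ins

∑-zero : {f : Fin n → ℕ} → (∀ i → f i ≡ 0) → ∑[ i < n ] f i ≡ 0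
∑-zero {n} f≗0 = trans (sum-cong-≗ f≗0) (sum-replicate-zero n)

-- An occupied spot is never vacated, so no final state has `e` empty.
circular-leaving-inside : (L : Subset m) (e : Fin (suc n)) (S : Subset (suc n)) →
                          lookup S e ≡ inside → circular L (leaving e) S ≡ 0
circular-leaving-inside []      e S ins = cong vacant ins
circular-leaving-inside (l ∷ L) e S ins = ∑-zero λ a → trans
  (cong (weight l (lookup S a) *ᴺ_)
    (circular-leaving-inside L e (circularPark S a) ([]≔-inside S (circularSpot S a) e ins)))
  (ℕ.*-zeroʳ (weight l (lookup S a)))

Extends : Subset n → Subset (suc n) → Set
Extends {n} S S′ = (∀ x → lookup S′ (inject₁ x) ≡ lookup S x) × lookup S′ (fromℕ n) ≡ outside

[]≔-extends : (S : Subset n) (S′ : Subset (suc n)) → Extends S S′ → ∀ s {b} →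
              Extends (S [ s ]≔ b) (S′ [ inject₁ s ]≔ b)
[]≔-extends S S′ (ext , last) s {b} = ext′ , trans (lookup∘update′ fromℕ≢inject₁ S′ b) last
  where
  ext′ : ∀ x → lookup (S′ [ inject₁ s ]≔ b) (inject₁ x) ≡ lookup (S [ s ]≔ b) x
  ext′ x with x ≟ s
  ... | yes refl = trans (lookup∘update (inject₁ s) S′ b) (sym (lookup∘update s S b))
  ... | no x≢s   = trans (lookup∘update′ (x≢s ∘ inject₁-injective) S′ b)
                     (trans (ext x) (sym (lookup∘update′ x≢s S b)))

extends-inside : (S : Subset n) (S′ : Subset (suc n)) → Extends S S′ → (a s : Fin (suc n)) →
  (∀ t → toℕ a ≤ toℕ t → toℕ t < toℕ s → lookup S t ≡ inside) →
  (∀ t → toℕ a ≤ toℕ t → toℕ t < toℕ s → lookup S′ t ≡ inside)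
extends-inside {n} S S′ (ext , _) a s ins t a≤t t<s with view t
... | ‵fromℕ     = contradiction t<s
                     (ℕ.≤⇒≯ (ℕ.≤-trans (s≤s⁻¹ (toℕ<n s)) (ℕ.≤-reflexive (sym (toℕ-fromℕ n)))))
... | ‵inject₁ t = trans (ext t)
                     (ins t (subst (toℕ a ≤_) (toℕ-inject₁ t) a≤t) (subst (_< toℕ s) (toℕ-inject₁ t) t<s))

circularSpot-just : (S : Subset n) (S′ : Subset (suc n)) → Extends S S′ → ∀ a {s} →
                    spotFor S a ≡ just s → circularSpot S′ (inject₁ a) ≡ inject₁ s
circularSpot-just S S′ E@(ext , _) a {s} eq with spotFor-just S a eq
... | a≤s , out , ins = circularSpot-first S′ (inject₁ a) (inject₁ s)
  (subst₂ _≤_ (sym (toℕ-inject₁ a)) (sym (toℕ-inject₁ s)) a≤s)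
  (trans (ext s) out)
  (extends-inside S S′ E (inject₁ a) (inject₁ s) λ t a≤t t<s →
    ins t (subst (_≤ toℕ t) (toℕ-inject₁ a) a≤t) (subst (toℕ t <_) (toℕ-inject₁ s) t<s))

-- A car that would run off the end of the street reaches the extra spot next, and takes it.
circularSpot-nothing : (S : Subset n) (S′ : Subset (suc n)) → Extends S S′ → ∀ a →
                       spotFor S a ≡ nothing → circularSpot S′ (inject₁ a) ≡ fromℕ n
circularSpot-nothing {n} S S′ E@(_ , last) a eq = circularSpot-first S′ (inject₁ a) (fromℕ n)
  (subst₂ _≤_ (sym (toℕ-inject₁ a)) (sym (toℕ-fromℕ n)) (ℕ.<⇒≤ (toℕ<n a)))
  last
  (extends-inside S S′ E (inject₁ a) (fromℕ n) λ t a≤t _ →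
    spotFor-nothing S a eq t (subst (_≤ toℕ t) (toℕ-inject₁ a) a≤t))

circularSpot-fromℕ : (S′ : Subset (suc n)) → lookup S′ (fromℕ n) ≡ outside →
                     circularSpot S′ (fromℕ n) ≡ fromℕ n
circularSpot-fromℕ S′ last = circularSpot-first S′ _ _ ℕ.≤-refl last
  λ t n≤t t<n → contradiction t<n (ℕ.≤⇒≯ n≤t)

-- While the extra spot is vacant, circle and street move in step and give each car the same weight.
-- A car that prefers the extra spot, or overruns the street, fills it for good and contributes 0,
-- which on the street is the default for a failed car.
circular-leaving-linear : (L : Subset m) (S : Subset n) (S′ : Subset (suc n)) → Extends S S′ →
                          circular L (leaving (fromℕ n)) S′ ≡ linear L S
circular-leaving-linear []      S S′ (_ , last) = cong vacant last
circular-leaving-linear {n = n} (l ∷ L) S S′ E@(ext , last) = begin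
  ∑[ a < suc n ] f a
    ≡⟨ sum-init-last f ⟩
  ∑[ a < n ] f (inject₁ a) +ᴺ f (fromℕ n)
    ≡⟨ cong₂ _+ᴺ_ (sum-cong-≗ λ a → cong₂ (λ b c → weight l b *ᴺ c) (ext a) (step a))
         (parks-last (fromℕ n) (circularSpot-fromℕ S′ last)) ⟩
  linear (l ∷ L) S +ᴺ 0
    ≡⟨ ℕ.+-identityʳ _ ⟩
  linear (l ∷ L) S ∎
  where
  open ≡-Reasoning
  g f : Fin (suc n) → ℕ
  g a = circular L (leaving (fromℕ n)) (circularPark S′ a)
  f a = weight l (lookup S′ a) *ᴺ g a

  g-zero : ∀ a → circularSpot S′ a ≡ fromℕ n → g a ≡ 0
  g-zero a eq = circular-leaving-inside L (fromℕ n) (circularPark S′ a)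
    (trans (cong (λ s → lookup (S′ [ s ]≔ inside) (fromℕ n)) eq) (lookup∘update (fromℕ n) S′ inside))

  parks-last : ∀ a → circularSpot S′ a ≡ fromℕ n → f a ≡ 0
  parks-last a eq = trans (cong (weight l (lookup S′ a) *ᴺ_) (g-zero a eq)) (ℕ.*-zeroʳ (weight l (lookup S′ a)))

  step : ∀ a → g (inject₁ a) ≡ maybe′ (λ s → linear L (S [ s ]≔ inside)) 0 (spotFor S a)
  step a with spotFor S a in eq
  ... | nothing = g-zero (inject₁ a) (circularSpot-nothing S S′ E a eq)
  ... | just s  = trans
    (cong (λ x → circular L (leaving (fromℕ n)) (S′ [ x ]≔ inside)) (circularSpot-just S S′ E a eq))
    (circular-leaving-linear L (S [ s ]≔ inside) (S′ [ inject₁ s ]≔ inside) ([]≔-extends S S′ E s))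

⊥-extends : Extends (⊥ {n}) ⊥
⊥-extends {n} = (λ x → trans (lookup-replicate (inject₁ x) outside) (sym (lookup-replicate x outside)))
              , lookup-replicate (fromℕ n) outside

-- Counting preference vectors

filter-map : (P? : Decidable P) (f : A → B) (xs : List A) →
             length (filter P? (map f xs)) ≡ length (filter (P? ∘ f) xs)
filter-map P? f []       = refl
filter-map P? f (x ∷ xs) with does (P? (f x))
... | true  = cong suc (filter-map P? f xs)
... | false = filter-map P? f xs

filter-cartesianProductWith :
  (P? : Decidable P) (f : A → B → C) (g : Fin n → A) (ys : List B) →
  length (filter P? (cartesianProductWith f (tabulate g) ys)) ≡
  ∑[ i < n ] length (filter (λ y → P? (f (g i) y)) ys)
filter-cartesianProductWith {n = zero}  P? f g ys = refl
filter-cartesianProductWith {n = suc n} P? f g ys = begin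
  length (filter P? (map (f (g zero)) ys ++ rest))
    ≡⟨ cong length (filter-++ P? (map (f (g zero)) ys) rest) ⟩
  length (filter P? (map (f (g zero)) ys) ++ filter P? rest)
    ≡⟨ length-++ (filter P? (map (f (g zero)) ys)) ⟩
  length (filter P? (map (f (g zero)) ys)) +ᴺ length (filter P? rest)
    ≡⟨ cong₂ _+ᴺ_ (filter-map P? (f (g zero)) ys) (filter-cartesianProductWith P? f (g ∘ suc) ys) ⟩
  ∑[ i < suc n ] length (filter (λ y → P? (f (g i) y)) ys) ∎
  where
  open ≡-Reasoning
  rest = cartesianProductWith f (tabulate (g ∘ suc)) ys

-- Being a parking function with one lucky car, generalised to a partly occupied street and a set of
-- lucky cars, so that the first car can be split off in an induction.
Good : Subset m → Subset n → Vec (Fin n) m → Set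
Good L S as = (∀ k → Is-just (lookup (parkFrom S as) k))
            × (∀ k → lookup L k ≡ inside → lookup (parkFrom S as) k ≡ just (lookup as k))

good-∷⁺ : ∀ {l} {L : Subset m} {S : Subset n} {a s as} → spotFor S a ≡ just s →
          (l ≡ inside → s ≡ a) → Good L (S [ s ]≔ inside) as → Good (l ∷ L) S (a ∷ as)
good-∷⁺ eq lucky (parks , luckies) rewrite eq =
  (λ { zero → Maybe.just _ ; (suc k) → parks k }) ,
  (λ { zero l≡ → cong just (lucky l≡) ; (suc k) → luckies k })

good-∷⁻ : ∀ {l} {L : Subset m} {S : Subset n} {a s as} → spotFor S a ≡ just s →
          Good (l ∷ L) S (a ∷ as) → (l ≡ inside → s ≡ a) × Good L (S [ s ]≔ inside) as
good-∷⁻ eq (parks , luckies) rewrite eq = just-injective ∘ luckies zero , parks ∘ suc , luckies ∘ suc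

-- The predicate is any `P` equivalent to `Good`, because once the first preference `a` is fixed,
-- the filter tests `P (a ∷ as)` with the decision inherited from `P?`.
filter-good : (L : Subset m) (S : Subset n) {P : Vec (Fin n) m → Set} (P? : Decidable P) →
              P ≐ Good L S → length (filter P? (allVecs n m)) ≡ linear L S
filter-good []      S P? (P⇒ , ⇒P) =
  cong length (filter-all P? {[] ∷ []} (⇒P ((λ ()) , (λ ())) All.∷ All.[]))
filter-good {suc m} {n} (l ∷ L) S {P} P? (P⇒ , ⇒P) = trans
  (filter-cartesianProductWith P? _∷_ id (allVecs n m))
  (sum-cong-≗ step)
  where
  count : Fin n → ℕ
  count a = length (filter (λ as → P? (a ∷ as)) (allVecs n m))

  none : ∀ a → (∀ as → ¬ P (a ∷ as)) → count a ≡ 0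
  none a ¬P = cong length (filter-none (λ as → P? (a ∷ as)) (All.universal ¬P (allVecs n m)))

  some : ∀ a s → spotFor S a ≡ just s → (l ≡ inside → s ≡ a) →
         count a ≡ 1 *ᴺ linear L (S [ s ]≔ inside)
  some a s eq lucky = trans
    (filter-good L (S [ s ]≔ inside) (λ as → P? (a ∷ as))
      (proj₂ ∘ good-∷⁻ eq ∘ P⇒ , ⇒P ∘ good-∷⁺ eq lucky))
    (sym (ℕ.*-identityˡ _))

  -- `l′` and `b` stand for `l` and `lookup S a`: splitting on them evaluates `weight`, while the
  -- equations keep the link.
  parked : ∀ a s → spotFor S a ≡ just s → ∀ l′ b → l ≡ l′ → lookup S a ≡ b →
           count a ≡ weight l′ b *ᴺ linear L (S [ s ]≔ inside)
  parked a s eq outside b       refl a≡ = some a s eq λ ()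
  parked a s eq inside  outside refl a≡ = some a s eq λ _ → spotFor-vacant S a eq a≡
  -- Luck would force `s` to be `a`, but `s` is vacant and `a` is occupied.
  parked a s eq inside  inside  refl a≡ = none a λ as p →
    contradiction (trans (sym a≡) (trans (cong (lookup S) (sym (proj₁ (good-∷⁻ eq (P⇒ p)) refl)))
      (proj₁ (proj₂ (spotFor-just S a eq))))) λ ()

  step : ∀ a → count a ≡ weight l (lookup S a) *ᴺ
                         maybe′ (λ s → linear L (S [ s ]≔ inside)) 0 (spotFor S a)
  step a with spotFor S a in eq
  ... | nothing = trans
    (none a λ as p → contradiction (subst Is-just eq (proj₁ (P⇒ p) zero)) λ ())
    (sym (ℕ.*-zeroʳ (weight l (lookup S a))))
  ... | just s = parked a s eq l (lookup S a) refl refl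

indicator : Dec A → ℕ
indicator A? = if does A? then 1 else 0

length-filter-∷ : (P? : Decidable P) (x : A) (xs : List A) →
                  length (filter P? (x ∷ xs)) ≡ indicator (P? x) +ᴺ length (filter P? xs)
length-filter-∷ P? x xs with does (P? x)
... | true  = refl
... | false = refl

indicator-true : (A? : Dec A) → A → indicator A? ≡ 1
indicator-true A? x = cong (if_then 1 else 0) (dec-true A? x)

indicator-false : (A? : Dec A) → ¬ A → indicator A? ≡ 0
indicator-false A? ¬x = cong (if_then 1 else 0) (dec-false A? ¬x)

∑-single : (f : Fin n → ℕ) (i : Fin n) → (∀ j → j ≢ i → f j ≡ 0) → ∑[ j < n ] f j ≡ f i
∑-single {suc n} f i f≗0 = trans (sum-remove {i = i} f)
  (trans (cong (f i +ᴺ_) (∑-zero λ j → f≗0 (punchIn i j) (punchInᵢ≢i i j))) (ℕ.+-identityʳ (f i)))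

-- An element satisfying `P` is counted in exactly one fibre, that of `f x`. Taking `R j` only up to
-- equivalence absorbs the order of the conjuncts in `q`.
filter-fibres : (P? : Decidable P) (f : A → Fin n) {R : Fin n → A → Set} (R? : ∀ j → Decidable (R j)) →
                (∀ j → R j ≐ (λ x → P x × f x ≡ j)) → ∀ xs →
                length (filter P? xs) ≡ ∑[ j < n ] length (filter (R? j) xs)
filter-fibres {n = n} P? f R? R≐ [] = sym (sum-replicate-zero n)
filter-fibres {n = n} P? f R? R≐ (x ∷ xs) = begin
  length (filter P? (x ∷ xs))
    ≡⟨ length-filter-∷ P? x xs ⟩
  indicator (P? x) +ᴺ length (filter P? xs)
    ≡⟨ cong₂ _+ᴺ_ (fibre (P? x)) (filter-fibres P? f R? R≐ xs) ⟩
  ∑[ j < n ] indicator (R? j x) +ᴺ ∑[ j < n ] length (filter (R? j) xs)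
    ≡⟨ ∑-distrib-+ (λ j → indicator (R? j x)) (λ j → length (filter (R? j) xs)) ⟨
  ∑[ j < n ] (indicator (R? j x) +ᴺ length (filter (R? j) xs))
    ≡⟨ sum-cong-≗ (λ j → length-filter-∷ (R? j) x xs) ⟨
  ∑[ j < n ] length (filter (R? j) (x ∷ xs)) ∎
  where
  open ≡-Reasoning
  fibre : (Px? : Dec _) → indicator Px? ≡ ∑[ j < n ] indicator (R? j x)
  fibre (yes p) = sym (trans
    (∑-single (λ j → indicator (R? j x)) (f x)
      (λ j j≢fx → indicator-false (R? j x) (j≢fx ∘ sym ∘ proj₂ ∘ proj₁ (R≐ j))))
    (indicator-true (R? (f x) x) (proj₂ (R≐ (f x)) (p , refl))))
  fibre (no ¬p) = sym (∑-zero λ j → indicator-false (R? j x) (¬p ∘ proj₁ ∘ proj₁ (R≐ j)))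

luckyCount≡∑q : ∀ n (i : Fin n) → luckyCount n i ≡ ∑[ j < n ] q n i j
luckyCount≡∑q n i = filter-fibres _ (λ a → lookup a i) _
  (λ j → (λ (p , eq , l) → (p , l) , eq) , (λ ((p , l) , eq) → p , eq , l))
  (allVecs n n)

luckyCount-linear : ∀ n (i : Fin n) → luckyCount n i ≡ linear ⁅ i ⁆ ⊥
luckyCount-linear n i = filter-good ⁅ i ⁆ ⊥ _
  ( (λ {a} (p , l) → p , λ k k∈ → subst (Lucky a) (sym (x∈⁅y⁆⇒x≡y i (lookup⇒[]= k ⁅ i ⁆ k∈))) l)
  , (λ (p , l) → p , l i ([]=⇒lookup (x∈⁅x⁆ i))))

-- Here n is `suc m`, and since labels start at 1, `suc (suc m) ∸ toℕ i` is n+2-i. Keeping the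
-- factor n+1 on the left avoids the exponent n-2, negative for n = 1.
luckyCount-closed : ∀ m (i : Fin (suc m)) →
  luckyCount (suc m) i *ᴺ suc (suc m) ≡ (suc (suc m) ∸ toℕ i) *ᴺ suc (suc m) ^ᴺ m
luckyCount-closed m i = begin
  luckyCount (suc m) i *ᴺ suc (suc m)
    ≡⟨ ℕ.*-comm (luckyCount (suc m) i) (suc (suc m)) ⟩
  suc (suc m) *ᴺ luckyCount (suc m) i
    ≡⟨ cong (suc (suc m) *ᴺ_) (luckyCount-linear (suc m) i) ⟩
  suc (suc m) *ᴺ linear ⁅ i ⁆ (⊥ {suc m})
    ≡⟨ cong (suc (suc m) *ᴺ_) (circular-leaving-linear ⁅ i ⁆ ⊥ ⊥ ⊥-extends) ⟨
  suc (suc m) *ᴺ circular ⁅ i ⁆ (leaving (fromℕ (suc m))) ⊥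
    ≡⟨ circular-leaving ⁅ i ⁆ (fromℕ (suc m)) ⟩
  choices (suc m) ⁅ i ⁆
    ≡⟨ choices-⁅⁆ (suc m) i ⟩
  (suc (suc m) ∸ toℕ i) *ᴺ suc (suc m) ^ᴺ m ∎
  where open ≡-Reasoning

-- Rational arithmetic

fromℤ-* : ∀ x y → fromℤ (x *ᶻ y) ≡ fromℤ x * fromℤ y
-- The product on the right computes to `(x *ᶻ y) / 1`.
fromℤ-* x y = sym (ℚ.↥p/↧p≡p (fromℤ (x *ᶻ y)))

fromℤ-^ : ∀ b k → fromℤ (+ (b ^ᴺ k)) ≡ fromℤ (+ b) Exp.^ k
fromℤ-^ b zero    = refl
fromℤ-^ b (suc k) = trans (cong fromℤ (ℤ.pos-* b (b ^ᴺ k)))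
  (trans (fromℤ-* (+ b) (+ (b ^ᴺ k))) (cong (fromℤ (+ b) *_) (fromℤ-^ b k)))

-- A negative exponent occurs only for `m` zero, where the power is `1/ p` and cancels against `p`.
^-pred : ∀ p .{{_ : NonZero p}} m → p ^ (+ suc m -ᶻ + 2) * p ≡ p Exp.^ m
^-pred p zero    = trans (cong (_* p) (ℚ.*-identityʳ (1/ p))) (ℚ.*-inverseˡ p)
^-pred p (suc m) = ℚ.*-comm (p Exp.^ m) p

*-cancelʳ : ∀ p .{{_ : NonZero p}} {x y} → x * p ≡ y * p → x ≡ y
*-cancelʳ p {x} {y} eq = trans (sym (undo x)) (trans (cong (_* 1/ p) eq) (undo y))
  where
  undo : ∀ z → z * p * 1/ p ≡ z
  undo z = trans (ℚ.*-assoc z p (1/ p)) (trans (cong (z *_) (ℚ.*-inverseʳ p)) (ℚ.*-identityʳ z))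

-- The fraction `x / suc k` is reduced to lowest terms, which hides its denominator; among
-- unnormalised rationals cross-multiplication settles the equality.
/-*-cancel : ∀ x k → x / suc k * fromℤ (+ suc k) ≡ fromℤ x
/-*-cancel x k = ℚ.toℚᵘ-injective
  (ℚᵘ.≃-trans (ℚ.toℚᵘ-homo-* (x / suc k) (fromℤ (+ suc k)))
  (ℚᵘ.≃-trans (ℚᵘ.*-congʳ (ℚ.toℚᵘ-fromℚᵘ (mkℚᵘ x k)))
  (*≡* (trans (ℤ.*-identityʳ (x *ᶻ + suc k)) (cong (λ z → x *ᶻ + suc z) (sym (ℕ.*-identityʳ k)))))))

fromℤ-- : ∀ x y → fromℤ x - fromℤ y ≡ fromℤ (x -ᶻ y)
fromℤ-- x y = trans (cong (λ z → fromℤ x + z) (neg y))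
  (trans (cong₂ (λ a b → (a +ᶻ b) / 1) (ℤ.*-identityʳ x) (ℤ.*-identityʳ (-ᶻ y)))
    (ℚ.↥p/↧p≡p (fromℤ (x -ᶻ y))))
  where
  -- Rational negation is defined by cases on the numerator, so it computes only after this split.
  neg : ∀ y → - fromℤ y ≡ fromℤ (-ᶻ y)
  neg (+ zero)  = refl
  neg (+ suc _) = refl
  neg -[1+ _ ]  = refl

n+2-label : ∀ m (i : Fin (suc m)) → + (suc m +ᴺ 2) -ᶻ + label i ≡ + (suc (suc m) ∸ toℕ i)
n+2-label m i = begin
  + (suc m +ᴺ 2) -ᶻ + label i
    ≡⟨ cong (λ k → + suc k -ᶻ + label i) (ℕ.+-comm m 2) ⟩
  + suc (suc (suc m)) -ᶻ + label i
    ≡⟨ ℤ.m-n≡m⊖n (suc (suc (suc m))) (label i) ⟩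
  suc (suc (suc m)) ⊖ label i
    ≡⟨ ℤ.⊖-≥ (s≤s (ℕ.≤-trans (ℕ.<⇒≤ (toℕ<n i)) (ℕ.n≤1+n _))) ⟩
  + (suc (suc m) ∸ toℕ i) ∎
  where open ≡-Reasoning

module _ (m : ℕ) (i : Fin (suc m)) where
  private
    p c u : ℚ
    p = fromℤ (+ suc (suc m))
    c = fromℤ (+ (suc m +ᴺ 2) -ᶻ + label i)
    u = 1ℚ - (+ label i -ᶻ + 1) / suc (suc m)

  luckyCount-power : fromℤ (+ luckyCount (suc m) i) ≡ c * p ^ (+ suc m -ᶻ + 2)
  -- Multiplying by n+1 makes the exponent natural and brings in `luckyCount-closed`.
  luckyCount-power = *-cancelʳ p (begin
    fromℤ (+ luckyCount (suc m) i) * p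
      ≡⟨ fromℤ-* (+ luckyCount (suc m) i) (+ suc (suc m)) ⟨
    fromℤ (+ luckyCount (suc m) i *ᶻ + suc (suc m))
      ≡⟨ cong fromℤ (ℤ.pos-* (luckyCount (suc m) i) (suc (suc m))) ⟨
    fromℤ (+ (luckyCount (suc m) i *ᴺ suc (suc m)))
      ≡⟨ cong (fromℤ ∘ +_) (luckyCount-closed m i) ⟩
    fromℤ (+ ((suc (suc m) ∸ toℕ i) *ᴺ suc (suc m) ^ᴺ m))
      ≡⟨ cong fromℤ (ℤ.pos-* (suc (suc m) ∸ toℕ i) (suc (suc m) ^ᴺ m)) ⟩
    fromℤ (+ (suc (suc m) ∸ toℕ i) *ᶻ + (suc (suc m) ^ᴺ m))
      ≡⟨ fromℤ-* (+ (suc (suc m) ∸ toℕ i)) (+ (suc (suc m) ^ᴺ m)) ⟩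
    fromℤ (+ (suc (suc m) ∸ toℕ i)) * fromℤ (+ (suc (suc m) ^ᴺ m))
      ≡⟨ cong₂ _*_ (cong fromℤ (sym (n+2-label m i))) (fromℤ-^ (suc (suc m)) m) ⟩
    c * p Exp.^ m
      ≡⟨ cong (c *_) (^-pred p m) ⟨
    c * (p ^ (+ suc m -ᶻ + 2) * p)
      ≡⟨ ℚ.*-assoc c (p ^ (+ suc m -ᶻ + 2)) p ⟨
    c * p ^ (+ suc m -ᶻ + 2) * p ∎)
    where open ≡-Reasoning

  u*p≡c : u * p ≡ c
  u*p≡c = begin
    (1ℚ - x) * p
      ≡⟨ ℚ.*-distribʳ-+ p 1ℚ (- x) ⟩
    1ℚ * p + - x * p
      ≡⟨ cong₂ _+_ (ℚ.*-identityˡ p) (sym (ℚ.neg-distribˡ-* x p)) ⟩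
    p - x * p
      -- The numerator `+ label i -ᶻ + 1` computes to `+ toℕ i`.
      ≡⟨ cong (λ y → p - y) (/-*-cancel (+ toℕ i) (suc m)) ⟩
    p - fromℤ (+ toℕ i)
      ≡⟨ fromℤ-- (+ suc (suc m)) (+ toℕ i) ⟩
    fromℤ (+ suc (suc m) -ᶻ + toℕ i)
      ≡⟨ cong fromℤ (trans (ℤ.m-n≡m⊖n (suc (suc m)) (toℕ i))
           (ℤ.⊖-≥ (ℕ.≤-trans (ℕ.<⇒≤ (toℕ<n i)) (ℕ.n≤1+n _)))) ⟩
    fromℤ (+ (suc (suc m) ∸ toℕ i))
      ≡⟨ cong fromℤ (n+2-label m i) ⟨
    c ∎
    where
    open ≡-Reasoning
    x = (+ label i -ᶻ + 1) / suc (suc m)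

  -- By `u*p≡c`, one factor n+1 of `c` can be moved into the power.
  power-pred : c * p ^ (+ suc m -ᶻ + 2) ≡ u * p ^ (+ suc m -ᶻ + 1)
  power-pred = begin
    c * r                          ≡⟨ cong (_* r) u*p≡c ⟨
    u * p * r                      ≡⟨ ℚ.*-assoc u p r ⟩
    u * (p * r)                    ≡⟨ cong (u *_) (trans (ℚ.*-comm p r) (^-pred p m)) ⟩
    u * p ^ (+ suc m -ᶻ + 1)       ∎
    where
    open ≡-Reasoning
    r = p ^ (+ suc m -ᶻ + 2)

corollary3p1 : (n : ℕ) → n ≥ 1 → (i : Fin n) →
    (luckyCount n i ≡ ∑[ j < n ] q n i j)
    × (fromℤ (+ (∑[ j < n ] q n i j))
    ≡ fromℤ (+ (n +ᴺ 2) -ᶻ + label i) * fromℤ (+ suc n) ^ (+ n -ᶻ + 2))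
    × (fromℤ (+ (n +ᴺ 2) -ᶻ + label i) * fromℤ (+ suc n) ^ (+ n -ᶻ + 2)
    ≡ (1ℚ - (+ label i -ᶻ + 1) / suc n) * fromℤ (+ suc n) ^ (+ n -ᶻ + 1))
corollary3p1 (suc m) _ i =
    luckyCount≡∑q (suc m) i
  , trans (cong (fromℤ ∘ +_) (sym (luckyCount≡∑q (suc m) i))) (luckyCount-power m i)
  , power-pred m i
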